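{- For a theory $T$, suppose the formula $\mathrm{Proof}_T(z,x)$ states that "$z$ is (the Gödel code of) the proof of a formula (with Gödel code) $x$ in $T$", and suppose that $T$ has the following properties: (a) $T\vdash\overline{i}\neq\overline{j}$ and $T\vdash\overline{n}\leqslant\overline{m}$ and $T\vdash\forall y(\overline{m}\leqslant y\rightarrow\overline{n}\leqslant y)$, for any $i,j,n,m\in\mathbb{N}$ with $i\neq j$ and $n\leqslant m$; (b) $T\vdash\forall y(y\leqslant\overline{n}\vee\overline{n}\leqslant y)$, for all $n\in\mathbb{N}$; (c) $T\vdash\forall y\big(y\leqslant\overline{n}\leftrightarrow\bigvee_{i=0}^{n}y=\overline{i}\big)$, for all $n\in\mathbb{N}$; (d) if $T\vdash\phi$ and $k$ is the Gödel code of this proof, then $T\vdash\mathrm{Proof}_T(\overline{k},\ulcorner\phi\urcorner)$; (e) if $k$ is not the Gödel code of a proof of $\phi$ in $T$, then $T\vdash\neg\mathrm{Proof}_T(\overline{k},\ulcorner\phi\urcorner)$; in particular, if $T\not\vdash\phi$, then $T\vdash\neg\mathrm{Proof}_T(\overline{l},\ulcorner\phi\urcorner)$ for any $l\in\mathbb{N}$. Then weak representability of a function $f\colon\mathbb{N}\to\mathbb{N}$ in $T$ implies its representability in $T$.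
   Context: $\mathbb{N}$ is the set of natural numbers, including $0$. The language of the theory $T$ contains the relation symbol $\leqslant$ and, for each $n\in\mathbb{N}$, a term $\overline{n}$ indicating $n$. A primitive recursive Gödel coding $\alpha\mapsto\ulcorner\alpha\urcorner$ is fixed; inside formulas of $T$, $\ulcorner\phi\urcorner$ stands for the term indicating the Gödel code of $\phi$. In (d) and (e), $\phi$ is an arbitrary formula of the language of $T$ and $k\in\mathbb{N}$. A function $f\colon\mathbb{N}\to\mathbb{N}$ is weakly representable in $T$ if for some formula $\varphi(x,y)$ we have, for every $n,m\in\mathbb{N}$: if $f(n)=m$, then $T\vdash\varphi(\overline{n},\overline{m})$; and if $f(n)\neq m$, then $T\not\vdash\varphi(\overline{n},\overline{m})$. A function $f\colon\mathbb{N}\to\mathbb{N}$ is representable in $T$ if for some formula $\psi(x,y)$ we have, for every $n,m\in\mathbb{N}$: if $f(n)=m$, then $T\vdash\psi(\overline{n},\overline{m})$; and if $f(n)\neq m$, then $T\vdash\neg\psi(\overline{n},\overline{m})$.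
   Formalization: It is additionally assumed that for each formula φ(x,y) the function sending (n,m) to the Gödel code of φ(n̄,m̄) is representable in T, so that ⌜φ(x,y)⌝ can be used with x, y as parameters; (a)–(e) alone do not suffice. -}

module Defs where

open import Data.Fin using (Fin; zero; suc)
open import Data.List using (List; []; _∷_; map)
open import Data.List.Membership.Propositional using (_∈_)
open import Data.Nat using (ℕ; zero; suc)
open import Data.Product using (Σ; ∃; ∃-syntax; _×_; _,_)
open import Data.Vec using (Vec; []; _∷_; lookup)
open import Function.Bundles using (_↣_; Injection)
open import Relation.Binary.PropositionalEquality using (_≡_; _≢_)
open import Relation.Nullary using (¬_)

-- `Term Func n`: first-order terms whose variables are the de Bruijn indices in `Fin n`.
data Term (Func : ℕ → Set) (n : ℕ) : Set where
  var  : Fin n → Term Func n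
  func : ∀ {k} → Func k → Vec (Term Func n) k → Term Func n

-- Equality is a logical symbol, so it does not occur in `Rel`.  `numeral n` is the closed
-- term n̄; nothing about the numerals is assumed here (they need not come from a successor
-- symbol).
record Language : Set₁ where
  field
    Func    : ℕ → Set
    Rel     : ℕ → Set
    leq     : Rel 2
    numeral : ℕ → Term Func 0

open Language

Tm : Language → ℕ → Set
Tm L = Term (Func L)

infix  9 _≐_
infixr 8 _∧_
infixr 7 _∨_
infixr 6 _⇒_

data Formula (L : Language) (n : ℕ) : Set where
  rel     : ∀ {k} → Rel L k → Vec (Tm L n) k → Formula L n
  _≐_     : Tm L n → Tm L n → Formula L n
  ⊥ᶠ      : Formula L n
  _⇒_ _∧_ _∨_ : Formula L n → Formula L n → Formula L n
  ∀ᶠ ∃ᶠ   : Formula L (suc n) → Formula L n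

Sentence : Language → Set
Sentence L = Formula L 0

module _ {L : Language} {n : ℕ} where

  infix 10 ~_
  infix 9 _≼_
  infix 5 _⇔_

  ~_ : Formula L n → Formula L n
  ~ φ = φ ⇒ ⊥ᶠ

  _⇔_ : Formula L n → Formula L n → Formula L n
  φ ⇔ ψ = (φ ⇒ ψ) ∧ (ψ ⇒ φ)

  _≼_ : Tm L n → Tm L n → Formula L n
  s ≼ t = rel (leq L) (s ∷ t ∷ [])

  -- ⋁≤ n φ  is  φ 0 ∨ ⋯ ∨ φ n.
  ⋁≤ : ℕ → (ℕ → Formula L n) → Formula L n
  ⋁≤ zero    φ = φ 0
  ⋁≤ (suc k) φ = ⋁≤ k φ ∨ φ (suc k)

module _ {F : ℕ → Set} where

  mutual
    subᵗ : ∀ {m n} → (Fin m → Term F n) → Term F m → Term F n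
    subᵗ σ (var i)     = σ i
    subᵗ σ (func f ts) = func f (subᵗˢ σ ts)

    subᵗˢ : ∀ {m n k} → (Fin m → Term F n) → Vec (Term F m) k → Vec (Term F n) k
    subᵗˢ σ []       = []
    subᵗˢ σ (t ∷ ts) = subᵗ σ t ∷ subᵗˢ σ ts

  -- Extends a substitution under a binder, whose variable is index `zero`.
  ext : ∀ {m n} → (Fin m → Term F n) → Fin (suc m) → Term F (suc n)
  ext σ zero    = var zero
  ext σ (suc i) = subᵗ (λ j → var (suc j)) (σ i)

-- The closed term k̄, as a term in any context of variables.
num : (L : Language) → ∀ {n} → ℕ → Tm L n
num L k = subᵗ (λ ()) (numeral L k)

module _ {L : Language} where

  sub : ∀ {m n} → (Fin m → Tm L n) → Formula L m → Formula L n
  sub σ (rel r ts) = rel r (subᵗˢ σ ts)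
  sub σ (s ≐ t)    = subᵗ σ s ≐ subᵗ σ t
  sub σ ⊥ᶠ         = ⊥ᶠ
  sub σ (φ ⇒ ψ)    = sub σ φ ⇒ sub σ ψ
  sub σ (φ ∧ ψ)    = sub σ φ ∧ sub σ ψ
  sub σ (φ ∨ ψ)    = sub σ φ ∨ sub σ ψ
  sub σ (∀ᶠ φ)     = ∀ᶠ (sub (ext σ) φ)
  sub σ (∃ᶠ φ)     = ∃ᶠ (sub (ext σ) φ)

  weaken : ∀ {n} → Formula L n → Formula L (suc n)
  weaken = sub (λ i → var (suc i))

  fromSentence : ∀ {n} → Sentence L → Formula L n
  fromSentence = sub λ ()

  -- φ [ t ] replaces variable `zero` by t and lowers the other indices.
  _[_] : ∀ {n} → Formula L (suc n) → Tm L n → Formula L n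
  φ [ t ] = sub (λ { zero → t ; (suc i) → var i }) φ

  -- For φ(x₀,…,xₖ₋₁), where xᵢ is the de Bruijn index i:
  -- φ ⟦ n₀ ∷ ⋯ ∷ nₖ₋₁ ∷ [] ⟧  is the sentence  φ(n̄₀,…,n̄ₖ₋₁).
  _⟦_⟧ : ∀ {k} → Formula L k → Vec ℕ k → Sentence L
  φ ⟦ ns ⟧ = sub (λ i → num L (lookup ns i)) φ

-- A theory is given by an arbitrary set of axioms.
Theory : Language → Set₁
Theory L = Sentence L → Set

infix 3 _∣_⊢_ _⊢_

-- Natural deduction for classical first-order logic with equality.  Membership of an axiom
-- in the theory is an irrelevant argument, so that a derivation is a purely syntactic object
-- (and can be given a Gödel code).
data _∣_⊢_ {L : Language} (T : Theory L) {n : ℕ} (Γ : List (Formula L n)) :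
           Formula L n → Set where
  axiom   : ∀ {φ} → .(T φ) → T ∣ Γ ⊢ fromSentence φ
  hyp     : ∀ {φ} → φ ∈ Γ → T ∣ Γ ⊢ φ
  raa     : ∀ {φ} → T ∣ ~ φ ∷ Γ ⊢ ⊥ᶠ → T ∣ Γ ⊢ φ
  ⇒-intro : ∀ {φ ψ} → T ∣ φ ∷ Γ ⊢ ψ → T ∣ Γ ⊢ φ ⇒ ψ
  ⇒-elim  : ∀ {φ ψ} → T ∣ Γ ⊢ φ ⇒ ψ → T ∣ Γ ⊢ φ → T ∣ Γ ⊢ ψ
  ∧-intro : ∀ {φ ψ} → T ∣ Γ ⊢ φ → T ∣ Γ ⊢ ψ → T ∣ Γ ⊢ φ ∧ ψ
  ∧-elim₁ : ∀ {φ ψ} → T ∣ Γ ⊢ φ ∧ ψ → T ∣ Γ ⊢ φ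
  ∧-elim₂ : ∀ {φ ψ} → T ∣ Γ ⊢ φ ∧ ψ → T ∣ Γ ⊢ ψ
  ∨-intro₁ : ∀ {φ ψ} → T ∣ Γ ⊢ φ → T ∣ Γ ⊢ φ ∨ ψ
  ∨-intro₂ : ∀ {φ ψ} → T ∣ Γ ⊢ ψ → T ∣ Γ ⊢ φ ∨ ψ
  ∨-elim  : ∀ {φ ψ χ} → T ∣ Γ ⊢ φ ∨ ψ → T ∣ φ ∷ Γ ⊢ χ → T ∣ ψ ∷ Γ ⊢ χ → T ∣ Γ ⊢ χ
  ∀-intro : ∀ {φ} → T ∣ map weaken Γ ⊢ φ → T ∣ Γ ⊢ ∀ᶠ φ
  ∀-elim  : ∀ {φ} → T ∣ Γ ⊢ ∀ᶠ φ → (t : Tm L n) → T ∣ Γ ⊢ φ [ t ]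
  ∃-intro : ∀ {φ} (t : Tm L n) → T ∣ Γ ⊢ φ [ t ] → T ∣ Γ ⊢ ∃ᶠ φ
  ∃-elim  : ∀ {φ ψ} → T ∣ Γ ⊢ ∃ᶠ φ → T ∣ φ ∷ map weaken Γ ⊢ weaken ψ → T ∣ Γ ⊢ ψ
  ≐-refl  : ∀ {t} → T ∣ Γ ⊢ t ≐ t
  ≐-subst : ∀ {s t} φ → T ∣ Γ ⊢ s ≐ t → T ∣ Γ ⊢ φ [ s ] → T ∣ Γ ⊢ φ [ t ]

_⊢_ : ∀ {L} → Theory L → ∀ {n} → Formula L n → Set
T ⊢ φ = T ∣ [] ⊢ φ

-- A Gödel coding of the formulas of the language and of the proofs of T.  Any injective
-- coding is allowed; the use that is made of its primitive recursiveness is isolated in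
-- `RepresentableCoding` below.
record GödelCoding {L : Language} (T : Theory L) : Set where
  field
    formulas : (∃[ n ] Formula L n) ↣ ℕ
    proofs   : (∃[ n ] Σ (Formula L n) (T ⊢_)) ↣ ℕ

  ⌜_⌝ : ∀ {n} → Formula L n → ℕ
  ⌜ φ ⌝ = Injection.to formulas (_ , φ)

  ⌜_⌝ᵖ : ∀ {n} {φ : Formula L n} → T ⊢ φ → ℕ
  ⌜ d ⌝ᵖ = Injection.to proofs (_ , _ , d)

  _CodesProofOf_ : ∀ {n} → ℕ → Formula L n → Set
  k CodesProofOf φ = ∃[ d ] ⌜_⌝ᵖ {φ = φ} d ≡ k

module _ {L : Language} (T : Theory L) where

  WeaklyRepresentable : (ℕ → ℕ) → Set
  WeaklyRepresentable f = ∃[ φ ] ∀ n m →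
      (f n ≡ m → T ⊢ φ ⟦ n ∷ m ∷ [] ⟧)
    × (f n ≢ m → ¬ (T ⊢ φ ⟦ n ∷ m ∷ [] ⟧))

  Representable : (ℕ → ℕ) → Set
  Representable f = ∃[ ψ ] ∀ n m →
      (f n ≡ m → T ⊢ ψ ⟦ n ∷ m ∷ [] ⟧)
    × (f n ≢ m → T ⊢ ~ (ψ ⟦ n ∷ m ∷ [] ⟧))

  Representable₂ : (ℕ → ℕ → ℕ) → Set
  Representable₂ g = ∃[ σ ] ∀ n m k →
      (g n m ≡ k → T ⊢ σ ⟦ n ∷ m ∷ k ∷ [] ⟧)
    × (g n m ≢ k → T ⊢ ~ (σ ⟦ n ∷ m ∷ k ∷ [] ⟧))

  -- ⌜φ(x,y)⌝ can be used inside formulas of T with x and y as parameters: the function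
  -- (n,m) ↦ ⌜φ(n̄,m̄)⌝ is representable in T.  For a primitive recursive coding this function
  -- is primitive recursive, hence representable in the usual arithmetical theories.  It does
  -- not follow from properties of T that mention only the numerals of individual codes.
  RepresentableCoding : GödelCoding T → Set
  RepresentableCoding G = ∀ φ → Representable₂ (λ n m → ⌜ φ ⟦ n ∷ m ∷ [] ⟧ ⌝)
    where open GödelCoding G

{-# OPTIONS --safe #-}

-- Rosser's trick.  Say that z bounds a proof of φ(x,y) if both the code of some proof of φ(x,y)
-- and the code of φ(x,y) itself are at most z.  The representing formula ψ(x,y) says that some z
-- bounds a proof of φ(x,y) but, for all v ≤ z other than y, bounds no proof of φ(x,v).  All
-- quantifiers except that over z are bounded by z, so (c) decides the matrix of ψ at numerals,
-- and if f(n) = m, any z that bounds a proof of φ(n,m) is a witness.  If f(n) ≠ m, let K bound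
-- f(n) and a proof of φ(n,f(n)).  A witness z for ψ(n,m) satisfies z ≤ K or K ≤ z by (b): in the
-- former case z is standard and refuted by (e), and in the latter v = f(n) is a forbidden
-- competitor.
module Submission where

open import Defs
open import Data.Fin using (Fin; zero; suc; #_)
open import Data.List using (List; []; _∷_)
open import Data.List.Membership.Propositional using (_∈_)
open import Data.List.Relation.Unary.All using (All; []; _∷_)
open import Data.List.Relation.Unary.Any using (here; there)
open import Data.Nat using (ℕ; zero; suc; _≤_; _⊔_; _≟_)
open import Data.Nat.Properties using (≤-refl; ≤-trans; m≤n⇒m≤1+n; m≤m⊔n; m≤n⊔m)
open import Data.Product using (_×_; _,_; proj₁; proj₂)
open import Data.Vec using (Vec; []; _∷_; lookup; map)
open import Data.Vec.Properties using (lookup-map)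
open import Function using (_∘_)
open import Relation.Binary.PropositionalEquality
  using (_≡_; _≢_; refl; sym; trans; cong; cong₂; subst)
open import Relation.Nullary using (¬_; Dec; yes; no)

-- Substitution in terms.

module _ {F : ℕ → Set} where

  mutual
    subᵗ-cong : ∀ {m n} {σ τ : Fin m → Term F n} → (∀ i → σ i ≡ τ i) →
                ∀ t → subᵗ σ t ≡ subᵗ τ t
    subᵗ-cong e (var i)     = e i
    subᵗ-cong e (func f ts) = cong (func f) (subᵗˢ-cong e ts)

    subᵗˢ-cong : ∀ {m n k} {σ τ : Fin m → Term F n} → (∀ i → σ i ≡ τ i) →
                 (ts : Vec (Term F m) k) → subᵗˢ σ ts ≡ subᵗˢ τ ts
    subᵗˢ-cong e []       = refl
    subᵗˢ-cong e (t ∷ ts) = cong₂ _∷_ (subᵗ-cong e t) (subᵗˢ-cong e ts)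

  mutual
    subᵗ-var : ∀ {n} (t : Term F n) → subᵗ var t ≡ t
    subᵗ-var (var i)     = refl
    subᵗ-var (func f ts) = cong (func f) (subᵗˢ-var ts)

    subᵗˢ-var : ∀ {n k} (ts : Vec (Term F n) k) → subᵗˢ var ts ≡ ts
    subᵗˢ-var []       = refl
    subᵗˢ-var (t ∷ ts) = cong₂ _∷_ (subᵗ-var t) (subᵗˢ-var ts)

  mutual
    subᵗ-∘ : ∀ {l m n} (τ : Fin m → Term F n) (σ : Fin l → Term F m) t →
             subᵗ τ (subᵗ σ t) ≡ subᵗ (subᵗ τ ∘ σ) t
    subᵗ-∘ τ σ (var i)     = refl
    subᵗ-∘ τ σ (func f ts) = cong (func f) (subᵗˢ-∘ τ σ ts)

    subᵗˢ-∘ : ∀ {l m n k} (τ : Fin m → Term F n) (σ : Fin l → Term F m) (ts : Vec (Term F l) k) →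
              subᵗˢ τ (subᵗˢ σ ts) ≡ subᵗˢ (subᵗ τ ∘ σ) ts
    subᵗˢ-∘ τ σ []       = refl
    subᵗˢ-∘ τ σ (t ∷ ts) = cong₂ _∷_ (subᵗ-∘ τ σ t) (subᵗˢ-∘ τ σ ts)

  lookup-subᵗˢ : ∀ {m n k} (τ : Fin m → Term F n) (ts : Vec (Term F m) k) i →
                 lookup (subᵗˢ τ ts) i ≡ subᵗ τ (lookup ts i)
  lookup-subᵗˢ τ (t ∷ ts) zero    = refl
  lookup-subᵗˢ τ (t ∷ ts) (suc i) = lookup-subᵗˢ τ ts i

  ext-cong : ∀ {m n} {σ τ : Fin m → Term F n} → (∀ i → σ i ≡ τ i) → ∀ i → ext σ i ≡ ext τ i
  ext-cong e zero    = refl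
  ext-cong e (suc i) = cong (subᵗ _) (e i)

  ext-var : ∀ {n} (i : Fin (suc n)) → ext {F = F} var i ≡ var i
  ext-var zero    = refl
  ext-var (suc i) = refl

  ext-∘ : ∀ {l m n} (τ : Fin m → Term F n) (σ : Fin l → Term F m) i →
          subᵗ (ext τ) (ext σ i) ≡ ext (subᵗ τ ∘ σ) i
  ext-∘ τ σ zero    = refl
  ext-∘ τ σ (suc i) = trans (subᵗ-∘ (ext τ) (var ∘ suc) (σ i)) (sym (subᵗ-∘ (var ∘ suc) τ (σ i)))

-- Substitution in formulas.

module _ {L : Language} where

  sub-cong : ∀ {m n} {σ τ : Fin m → Tm L n} → (∀ i → σ i ≡ τ i) → ∀ φ → sub {L} σ φ ≡ sub τ φ
  sub-cong e (rel r ts) = cong (rel r) (subᵗˢ-cong e ts)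
  sub-cong e (s ≐ t)    = cong₂ _≐_ (subᵗ-cong e s) (subᵗ-cong e t)
  sub-cong e ⊥ᶠ         = refl
  sub-cong e (φ ⇒ ψ)    = cong₂ _⇒_ (sub-cong e φ) (sub-cong e ψ)
  sub-cong e (φ ∧ ψ)    = cong₂ _∧_ (sub-cong e φ) (sub-cong e ψ)
  sub-cong e (φ ∨ ψ)    = cong₂ _∨_ (sub-cong e φ) (sub-cong e ψ)
  sub-cong e (∀ᶠ φ)     = cong ∀ᶠ (sub-cong (ext-cong e) φ)
  sub-cong e (∃ᶠ φ)     = cong ∃ᶠ (sub-cong (ext-cong e) φ)

  sub-var : ∀ {n} (φ : Formula L n) → sub var φ ≡ φ
  sub-var (rel r ts) = cong (rel r) (subᵗˢ-var ts)
  sub-var (s ≐ t)    = cong₂ _≐_ (subᵗ-var s) (subᵗ-var t)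
  sub-var ⊥ᶠ         = refl
  sub-var (φ ⇒ ψ)    = cong₂ _⇒_ (sub-var φ) (sub-var ψ)
  sub-var (φ ∧ ψ)    = cong₂ _∧_ (sub-var φ) (sub-var ψ)
  sub-var (φ ∨ ψ)    = cong₂ _∨_ (sub-var φ) (sub-var ψ)
  sub-var (∀ᶠ φ)     = cong ∀ᶠ (trans (sub-cong ext-var φ) (sub-var φ))
  sub-var (∃ᶠ φ)     = cong ∃ᶠ (trans (sub-cong ext-var φ) (sub-var φ))

  sub-∘ : ∀ {l m n} (τ : Fin m → Tm L n) (σ : Fin l → Tm L m) φ →
          sub {L} τ (sub σ φ) ≡ sub (subᵗ τ ∘ σ) φ
  sub-∘ τ σ (rel r ts) = cong (rel r) (subᵗˢ-∘ τ σ ts)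
  sub-∘ τ σ (s ≐ t)    = cong₂ _≐_ (subᵗ-∘ τ σ s) (subᵗ-∘ τ σ t)
  sub-∘ τ σ ⊥ᶠ         = refl
  sub-∘ τ σ (φ ⇒ ψ)    = cong₂ _⇒_ (sub-∘ τ σ φ) (sub-∘ τ σ ψ)
  sub-∘ τ σ (φ ∧ ψ)    = cong₂ _∧_ (sub-∘ τ σ φ) (sub-∘ τ σ ψ)
  sub-∘ τ σ (φ ∨ ψ)    = cong₂ _∨_ (sub-∘ τ σ φ) (sub-∘ τ σ ψ)
  sub-∘ τ σ (∀ᶠ φ)     = cong ∀ᶠ (trans (sub-∘ (ext τ) (ext σ) φ) (sub-cong (ext-∘ τ σ) φ))
  sub-∘ τ σ (∃ᶠ φ)     = cong ∃ᶠ (trans (sub-∘ (ext τ) (ext σ) φ) (sub-cong (ext-∘ τ σ) φ))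

  -- Unlike `_⟦_⟧`, this allows open terms, so it can also permute variables and be used below a
  -- quantifier.
  _⟪_⟫ : ∀ {k n} → Formula L k → Vec (Tm L n) k → Formula L n
  φ ⟪ ts ⟫ = sub (lookup ts) φ

  sub-⟪⟫ : ∀ {k m n} (τ : Fin m → Tm L n) (φ : Formula L k) ts →
           sub τ (φ ⟪ ts ⟫) ≡ φ ⟪ subᵗˢ τ ts ⟫
  sub-⟪⟫ τ φ ts =
    trans (sub-∘ τ (lookup ts) φ) (sub-cong (λ i → sym (lookup-subᵗˢ τ ts i)) φ)

  -- Instantiating variable `zero` undoes the shift that `ext` applies to the other values of `σ`.
  -- This trades the instantiation of a single quantifier for a simultaneous substitution.
  ext-inst : ∀ {k n} (φ : Formula L (suc k)) (σ : Fin (suc k) → Tm L n) →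
             sub (ext (σ ∘ suc)) φ [ σ zero ] ≡ sub σ φ
  ext-inst φ σ = trans (sub-∘ _ _ φ) (sub-cong pointwise φ)
    where
    pointwise : ∀ i → _ ≡ σ i
    pointwise zero    = refl
    pointwise (suc i) = trans (subᵗ-∘ _ _ (σ (suc i))) (subᵗ-var (σ (suc i)))

  weaken-inst : ∀ {n} (φ : Formula L (suc n)) → sub (ext (var ∘ suc)) φ [ var zero ] ≡ φ
  weaken-inst φ = trans (ext-inst φ var) (sub-var φ)

-- Numerals under substitution.

module _ (L : Language) where

  nums : ∀ {k n} → Vec ℕ k → Vec (Tm L n) k
  nums = map (num L)

  num-closed : ∀ {m n} (τ : Fin m → Tm L n) k → subᵗ τ (num L k) ≡ num L k
  num-closed τ k = trans (subᵗ-∘ τ (λ ()) (numeral k)) (subᵗ-cong (λ ()) (numeral k))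
    where open Language L

  closed-lookup : ∀ {m n k} (τ : Fin m → Tm L n) (ns : Vec ℕ k) i →
                  subᵗ τ (num L (lookup ns i)) ≡ lookup (nums ns) i
  closed-lookup τ ns i = trans (num-closed τ (lookup ns i)) (sym (lookup-map i (num L) ns))

module _ {L : Language} where

  ⟦⟧≡⟪nums⟫ : ∀ {k} (φ : Formula L k) ns → φ ⟦ ns ⟧ ≡ φ ⟪ nums L ns ⟫
  ⟦⟧≡⟪nums⟫ φ ns = sub-cong (λ i → sym (lookup-map i (num L) ns)) φ

  ⟪⟫-⟦⟧ : ∀ {k l} (φ : Formula L k) ts (ns : Vec ℕ l) ms →
          subᵗˢ (λ i → num L (lookup ns i)) ts ≡ nums L ms → (φ ⟪ ts ⟫) ⟦ ns ⟧ ≡ φ ⟦ ms ⟧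
  ⟪⟫-⟦⟧ φ ts ns ms e =
    trans (sub-⟪⟫ _ φ ts) (trans (cong (φ ⟪_⟫) e) (sym (⟦⟧≡⟪nums⟫ φ ms)))

  weaken-⟦⟧ : ∀ {k} (φ : Formula L k) ns → weaken (φ ⟦ ns ⟧) ≡ φ ⟪ nums L ns ⟫
  weaken-⟦⟧ φ ns = trans (sub-∘ _ _ φ) (sub-cong (closed-lookup L _ ns) φ)

  -- Numerals are closed, so the shift below a quantifier leaves them unchanged.
  ext-⟦⟧ : ∀ {k} (φ : Formula L (suc k)) ns →
           sub (ext (λ i → num L {0} (lookup ns i))) φ ≡ φ ⟪ var zero ∷ nums L ns ⟫
  ext-⟦⟧ φ ns = sub-cong pointwise φ
    where
    pointwise : ∀ i → ext (λ j → num L (lookup ns j)) i ≡ lookup (var zero ∷ nums L ns) i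
    pointwise zero    = refl
    pointwise (suc i) = closed-lookup L _ ns i

-- Derived rules of natural deduction.

pattern h₀ = here refl
pattern h₁ = there h₀
pattern h₂ = there h₁
pattern h₃ = there h₂
pattern h₄ = there h₃
pattern h₅ = there h₄
pattern h₆ = there h₅
pattern h₇ = there h₆
pattern h₈ = there h₇

module _ {L : Language} {T : Theory L} where

  conv : ∀ {n} {Γ : List (Formula L n)} {φ ψ} → φ ≡ ψ → T ∣ Γ ⊢ φ → T ∣ Γ ⊢ ψ
  conv {Γ = Γ} = subst (T ∣ Γ ⊢_)

  cut : ∀ {n} {Γ : List (Formula L n)} {φ ψ} → T ∣ Γ ⊢ φ → T ∣ φ ∷ Γ ⊢ ψ → T ∣ Γ ⊢ ψ
  cut p q = ⇒-elim (⇒-intro q) p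

  ∃-introˢ : ∀ {k n} {Γ : List (Formula L n)} (φ : Formula L (suc k)) σ →
             T ∣ Γ ⊢ sub σ φ → T ∣ Γ ⊢ sub (σ ∘ suc) (∃ᶠ φ)
  ∃-introˢ φ σ p = ∃-intro (σ zero) (conv (sym (ext-inst φ σ)) p)

  ∀-elimˢ : ∀ {k n} {Γ : List (Formula L n)} (φ : Formula L (suc k)) σ →
            T ∣ Γ ⊢ sub (σ ∘ suc) (∀ᶠ φ) → T ∣ Γ ⊢ sub σ φ
  ∀-elimˢ φ σ p = conv (ext-inst φ σ) (∀-elim p (σ zero))

  ≐-subst-⟪⟫ : ∀ {k n} {Γ : List (Formula L n)} (φ : Formula L (suc k)) ts {s t} →
               T ∣ Γ ⊢ s ≐ t → T ∣ Γ ⊢ φ ⟪ s ∷ ts ⟫ → T ∣ Γ ⊢ φ ⟪ t ∷ ts ⟫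
  ≐-subst-⟪⟫ φ ts {s} {t} p q =
    conv (ext-inst φ (lookup (t ∷ ts)))
      (≐-subst _ p (conv (sym (ext-inst φ (lookup (s ∷ ts)))) q))

  ≐-sym : ∀ {n} {Γ : List (Formula L n)} {s t} → T ∣ Γ ⊢ s ≐ t → T ∣ Γ ⊢ t ≐ s
  ≐-sym {s = s} p = ≐-subst-⟪⟫ (var (# 0) ≐ var (# 1)) (s ∷ []) p ≐-refl

  -- Instantiating a shifted universal hypothesis at the fresh variable gives back its body. In this
  -- way closed universal theorems are used below a binder.
  ∀-hyp : ∀ {n} {Γ : List (Formula L (suc n))} {φ} → weaken (∀ᶠ φ) ∈ Γ → T ∣ Γ ⊢ φ
  ∀-hyp {φ = φ} φ∈Γ = conv (weaken-inst φ) (∀-elim (hyp φ∈Γ) (var zero))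

  ∀-distrib : ∀ {n} {φ ψ : Formula L (suc n)} → T ⊢ ∀ᶠ (φ ⇒ ψ) → T ⊢ ∀ᶠ φ → T ⊢ ∀ᶠ ψ
  ∀-distrib p = ⇒-elim (⇒-elim (⇒-intro (⇒-intro (∀-intro
    (⇒-elim (∀-hyp h₁) (∀-hyp h₀))))) p)

  -- Closed theorems enter an open derivation as hypotheses, which makes the admissibility of
  -- substitution and weakening in derivations dispensable.
  ∀-cut : ∀ {n} {Γ : List (Formula L (suc n))} {φ} →
          All (λ γ → T ⊢ ∀ᶠ γ) Γ → T ∣ Γ ⊢ φ → T ⊢ ∀ᶠ φ
  ∀-cut []       q = ∀-intro q
  ∀-cut (p ∷ ps) q = ∀-distrib (∀-cut ps (⇒-intro q)) p

  ∀-weaken : ∀ {n} {φ : Formula L n} → T ⊢ φ → T ⊢ ∀ᶠ (weaken φ)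
  ∀-weaken p = cut p (∀-intro (hyp h₀))

  ∀-weaken-⟦⟧ : ∀ {k} (φ : Formula L k) ns → T ⊢ φ ⟦ ns ⟧ → T ⊢ ∀ᶠ (φ ⟪ nums L ns ⟫)
  ∀-weaken-⟦⟧ φ ns p = conv (cong ∀ᶠ (weaken-⟦⟧ φ ns)) (∀-weaken p)

  ¬∃ : ∀ {n} {φ : Formula L (suc n)} → T ⊢ ∀ᶠ (~ φ) → T ⊢ ~ ∃ᶠ φ
  ¬∃ {φ = φ} p = cut p (⇒-intro (∃-elim (hyp h₀)
    (⇒-elim (∀-hyp {φ = ~ φ} h₂) (hyp h₀))))

  ex-falso : ∀ {n} {φ ψ : Formula L n} → T ⊢ ~ φ → T ⊢ φ ⇒ ψ
  ex-falso p = cut p (⇒-intro (raa (⇒-elim (hyp h₂) (hyp h₁))))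

-- Bounded quantifiers whose bound is a numeral.

module Rosser {L : Language} {T : Theory L}
  (numerals-distinct : ∀ i j → i ≢ j → T ⊢ ~ (num L {0} i ≐ num L j))
  (numerals-ordered : ∀ n m → n ≤ m →
    (T ⊢ num L {0} n ≼ num L m) ×
    (T ⊢ ∀ᶠ {n = 0} (num L m ≼ var zero ⇒ num L n ≼ var zero)))
  (comparable : ∀ n → T ⊢ ∀ᶠ {n = 0} (var zero ≼ num L n ∨ num L n ≼ var zero))
  (bounded : ∀ n →
    T ⊢ ∀ᶠ {n = 0} (var zero ≼ num L n ⇔ ⋁≤ n (λ i → var zero ≐ num L i)))
  where

  -- By (c), y ≤ n splits into the finitely many cases y = i with i ≤ n. In each of them the theorem
  -- at the numeral i is carried over to y by substitution of equals.
  ∀≤-intro-open : ∀ {k} (φ : Formula L (suc k)) ns n →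
    (∀ i → i ≤ n → T ⊢ φ ⟦ i ∷ ns ⟧) →
    T ⊢ ∀ᶠ (var zero ≼ num L n ⇒ φ ⟪ var zero ∷ nums L ns ⟫)
  ∀≤-intro-open φ ns n p = ∀-cut (bounded n ∷ cases n p ∷ [])
    (⇒-intro (⇒-elim (hyp h₂) (⇒-elim (∧-elim₁ (hyp h₁)) (hyp h₀))))
    where
    case : ∀ i → T ⊢ φ ⟦ i ∷ ns ⟧ → T ⊢ ∀ᶠ (var zero ≐ num L i ⇒ φ ⟪ var zero ∷ nums L ns ⟫)
    case i q = ∀-cut (∀-weaken-⟦⟧ φ (i ∷ ns) q ∷ [])
      (⇒-intro (≐-subst-⟪⟫ φ (nums L ns) (≐-sym (hyp h₀)) (hyp h₁)))

    cases : ∀ l → (∀ i → i ≤ l → T ⊢ φ ⟦ i ∷ ns ⟧) →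
            T ⊢ ∀ᶠ (⋁≤ l (λ i → var zero ≐ num L i) ⇒ φ ⟪ var zero ∷ nums L ns ⟫)
    cases zero    q = case zero (q zero ≤-refl)
    cases (suc l) q =
      ∀-cut (cases l (λ i i≤l → q i (m≤n⇒m≤1+n i≤l)) ∷ case (suc l) (q (suc l) ≤-refl) ∷ [])
        (⇒-intro (∨-elim (hyp h₀)
          (⇒-elim (hyp h₂) (hyp h₀))
          (⇒-elim (hyp h₃) (hyp h₀))))

  -- Here the bound is a variable of the formula and becomes a numeral only on instantiation, as it
  -- does for the quantifiers bounded by z in the Rosser formula.
  ∀≤-intro : ∀ {k} (φ : Formula L (suc k)) ns j →
    (∀ i → i ≤ lookup ns j → T ⊢ φ ⟦ i ∷ ns ⟧) →
    T ⊢ (∀ᶠ (var zero ≼ var (suc j) ⇒ φ)) ⟦ ns ⟧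
  ∀≤-intro φ ns j p =
    conv (cong ∀ᶠ (cong₂ _⇒_ (cong (var zero ≼_) (sym (num-closed L _ (lookup ns j))))
                             (sym (ext-⟦⟧ φ ns))))
      (∀≤-intro-open φ ns (lookup ns j) p)

  ¬∃≤ : ∀ {k} (φ : Formula L (suc k)) ns j →
    (∀ i → i ≤ lookup ns j → T ⊢ ~ (φ ⟦ i ∷ ns ⟧)) →
    T ⊢ ~ ((∃ᶠ (var zero ≼ var (suc j) ∧ φ)) ⟦ ns ⟧)
  ¬∃≤ φ ns j p = ¬∃ (∀-cut (∀≤-intro (~ φ) ns j p ∷ [])
    (⇒-intro (⇒-elim (⇒-elim (hyp h₁) (∧-elim₁ (hyp h₀))) (∧-elim₂ (hyp h₀)))))

  -- The Rosser formula.

  -- The variables of M are c, w, x, y, where w is the code of a proof of the formula φ(x,y)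
  -- with code c.
  module _ (M : Formula L 4) where

    cwxy : Vec (Tm L 5) 4
    cwxy = var (# 0) ∷ var (# 1) ∷ var (# 3) ∷ var (# 4) ∷ []

    -- Variables w, z, x, y.
    HasCode≤ : Formula L 4
    HasCode≤ = ∃ᶠ (var (# 0) ≼ var (# 2) ∧ M ⟪ cwxy ⟫)

    -- Variables z, x, y.
    HasWitness≤ : Formula L 3
    HasWitness≤ = ∃ᶠ (var (# 0) ≼ var (# 1) ∧ HasCode≤)

    zxv : Vec (Tm L 4) 3
    zxv = var (# 1) ∷ var (# 2) ∷ var (# 0) ∷ []

    -- Variables v, z, x, y.
    NotRival : Formula L 4
    NotRival = HasWitness≤ ⟪ zxv ⟫ ⇒ var (# 0) ≐ var (# 3)

    -- Variables z, x, y.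
    NoRival≤ : Formula L 3
    NoRival≤ = ∀ᶠ (var (# 0) ≼ var (# 1) ⇒ NotRival)

    Graph : Formula L 2
    Graph = ∃ᶠ (HasWitness≤ ∧ NoRival≤)

    -- Terms and context are arbitrary because z is a numeral in `graph-true` but the variable of
    -- the outer quantifier in `graph-false`.
    hasWitness-intro : ∀ {n} {Γ : List (Formula L n)} c w {z x y} →
      T ∣ Γ ⊢ c ≼ z → T ∣ Γ ⊢ w ≼ z → T ∣ Γ ⊢ M ⟪ c ∷ w ∷ x ∷ y ∷ [] ⟫ →
      T ∣ Γ ⊢ HasWitness≤ ⟪ z ∷ x ∷ y ∷ [] ⟫
    hasWitness-intro c w {z} {x} {y} c≼z w≼z p =
      ∃-introˢ (var (# 0) ≼ var (# 1) ∧ HasCode≤) (lookup (w ∷ z ∷ x ∷ y ∷ [])) (∧-intro w≼z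
        (∃-introˢ (var (# 0) ≼ var (# 2) ∧ M ⟪ cwxy ⟫) (lookup (c ∷ w ∷ z ∷ x ∷ y ∷ []))
          (∧-intro c≼z (conv (sym (sub-⟪⟫ _ M cwxy)) p))))

    -- Below the numeral k only finitely many numerals c and w are possible, and `p` refutes each
    -- pair.
    ¬hasWitness : ∀ n m → (∀ c w → T ⊢ ~ (M ⟦ c ∷ w ∷ n ∷ m ∷ [] ⟧)) →
                  ∀ k → T ⊢ ~ (HasWitness≤ ⟦ k ∷ n ∷ m ∷ [] ⟧)
    ¬hasWitness n m p k = ¬∃≤ HasCode≤ (k ∷ n ∷ m ∷ []) (# 0) λ w _ →
      ¬∃≤ (M ⟪ cwxy ⟫) (w ∷ k ∷ n ∷ m ∷ []) (# 1) λ c _ →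
        conv (cong ~_ (sym (⟪⟫-⟦⟧ M cwxy (c ∷ w ∷ k ∷ n ∷ m ∷ []) (c ∷ w ∷ n ∷ m ∷ []) refl))) (p c w)

    graph-true : ∀ n m c w → T ⊢ M ⟦ c ∷ w ∷ n ∷ m ∷ [] ⟧ →
      (∀ m′ → m ≢ m′ → ∀ c w → T ⊢ ~ (M ⟦ c ∷ w ∷ n ∷ m′ ∷ [] ⟧)) →
      T ⊢ Graph ⟦ n ∷ m ∷ [] ⟧
    graph-true n m c w p q =
      ∃-introˢ (HasWitness≤ ∧ NoRival≤) (λ i → num L (lookup (k ∷ n ∷ m ∷ []) i))
        (∧-intro hasWitness (∀≤-intro NotRival (k ∷ n ∷ m ∷ []) (# 0) λ i _ → noRival i))
      where
      -- The least z that bounds both the code of the formula and the code of its proof.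
      k = c ⊔ w

      hasWitness : T ⊢ HasWitness≤ ⟦ k ∷ n ∷ m ∷ [] ⟧
      hasWitness = conv (sym (⟦⟧≡⟪nums⟫ HasWitness≤ (k ∷ n ∷ m ∷ [])))
        (hasWitness-intro (num L c) (num L w)
          (proj₁ (numerals-ordered c k (m≤m⊔n c w))) (proj₁ (numerals-ordered w k (m≤n⊔m c w)))
          (conv (⟦⟧≡⟪nums⟫ M (c ∷ w ∷ n ∷ m ∷ [])) p))

      noRival : ∀ i → T ⊢ NotRival ⟦ i ∷ k ∷ n ∷ m ∷ [] ⟧
      noRival i with m ≟ i
      -- For v = m the conclusion of `NotRival` holds; for any other v its premise is refutable.
      ... | yes refl = ⇒-intro ≐-refl
      ... | no m≢i   = ex-falso
        (conv (cong ~_ (sym (⟪⟫-⟦⟧ HasWitness≤ zxv (i ∷ k ∷ n ∷ m ∷ []) (k ∷ n ∷ i ∷ []) refl)))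
          (¬hasWitness n i (q i m≢i) k))

    graph-false : ∀ n m m₀ c w → m₀ ≢ m → T ⊢ M ⟦ c ∷ w ∷ n ∷ m₀ ∷ [] ⟧ →
      (∀ c w → T ⊢ ~ (M ⟦ c ∷ w ∷ n ∷ m ∷ [] ⟧)) →
      T ⊢ ~ (Graph ⟦ n ∷ m ∷ [] ⟧)
    graph-false n m m₀ c w m₀≢m p q =
      ¬∃ (conv (cong (∀ᶠ ∘ ~_) (sym (ext-⟦⟧ (HasWitness≤ ∧ NoRival≤) (n ∷ m ∷ []))))
        (∀-cut
          -- In both cases of the disjunction these theorems are `h₂` to `h₈`, behind the case
          -- assumption `h₀` and the matrix `h₁`.
          ( comparable k
          ∷ ∀≤-intro-open (~ HasWitness≤) (n ∷ m ∷ []) k (λ i _ → ¬hasWitness n m q i)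
          ∷ proj₂ (numerals-ordered m₀ k (m≤m⊔n m₀ (c ⊔ w)))
          ∷ proj₂ (numerals-ordered c k (≤-trans (m≤m⊔n c w) (m≤n⊔m m₀ (c ⊔ w))))
          ∷ proj₂ (numerals-ordered w k (≤-trans (m≤n⊔m c w) (m≤n⊔m m₀ (c ⊔ w))))
          ∷ ∀-weaken-⟦⟧ M (c ∷ w ∷ n ∷ m₀ ∷ []) p
          ∷ ∀-weaken-⟦⟧ (~ (var (# 0) ≐ var (# 1))) (m₀ ∷ m ∷ []) (numerals-distinct m₀ m m₀≢m)
          ∷ [])
          (⇒-intro (∨-elim (hyp h₁) z≼k k≼z))))
      where
      -- The bound has to cover `m₀` as well, since `NoRival≤` only restricts competitors v ≤ z.
      k = m₀ ⊔ (c ⊔ w)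

      z≼k : T ∣ _ ⊢ ⊥ᶠ
      z≼k = ⇒-elim (⇒-elim (hyp h₃) (hyp h₀)) (∧-elim₁ (hyp h₁))

      k≼z : T ∣ _ ⊢ ⊥ᶠ
      -- By (a), k ≤ z puts `m₀`, `c` and `w` below z. Hence the competitor v = `m₀` has a witness,
      -- and `NotRival` yields the equality of the numerals of `m₀` and `m`, which `h₈` refutes.
      k≼z = ⇒-elim (hyp h₈)
        (⇒-elim
          (⇒-elim
            (∀-elimˢ (var (# 0) ≼ var (# 1) ⇒ NotRival)
              (lookup (num L m₀ ∷ var zero ∷ num L n ∷ num L m ∷ []))
              (∧-elim₂ (hyp h₁)))
            (⇒-elim (hyp h₄) (hyp h₀)))
          (conv (sym (sub-⟪⟫ _ HasWitness≤ zxv))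
            (hasWitness-intro (num L c) (num L w)
              (⇒-elim (hyp h₅) (hyp h₀))
              (⇒-elim (hyp h₆) (hyp h₀))
              (hyp h₇))))

-- The Rosser formula of the proof predicate.

theorem3p10 : (L : Language) (T : Theory L) (G : GödelCoding T) → let open GödelCoding G in
    RepresentableCoding T G →
    (Proofᵀ : Formula L 2) →
    ((i j : ℕ) → i ≢ j → T ⊢ ~ (num L {0} i ≐ num L j)) →
    ((n m : ℕ) → n ≤ m →
    (T ⊢ num L {0} n ≼ num L m) ×
    (T ⊢ ∀ᶠ {n = 0} (num L m ≼ var zero ⇒ num L n ≼ var zero))) →
    ((n : ℕ) → T ⊢ ∀ᶠ {n = 0} (var zero ≼ num L n ∨ num L n ≼ var zero)) →
    ((n : ℕ) → T ⊢ ∀ᶠ {n = 0} (var zero ≼ num L n ⇔ ⋁≤ n (λ i → var zero ≐ num L i))) →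
    (∀ {n} (φ : Formula L n) (d : T ⊢ φ) → T ⊢ Proofᵀ ⟦ ⌜ d ⌝ᵖ ∷ ⌜ φ ⌝ ∷ [] ⟧) →
    (∀ {n} (φ : Formula L n) (k : ℕ) → ¬ (k CodesProofOf φ) →
    T ⊢ ~ (Proofᵀ ⟦ k ∷ ⌜ φ ⌝ ∷ [] ⟧)) →
    (f : ℕ → ℕ) → WeaklyRepresentable T f → Representable T f
theorem3p10 L T G coding Proofᵀ distinct ordered comparable bounded proves refutes f (φ , weak) =
  Graph M , λ n m →
      (λ { refl → graph-true M n (f n) (code n (f n)) (proof n) (witness n) (rival n) })
    , (λ fn≢m → graph-false M n m (f n) (code n (f n)) (proof n) fn≢m (witness n) (rival n m fn≢m))
  where
  open GödelCoding G
  open Rosser {T = T} distinct ordered comparable bounded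

  σ : Formula L 3
  σ = proj₁ (coding φ)

  -- The code of φ(x,y) varies with x and y, and the language need not have a term for it; so it
  -- enters as a variable c that `σ` ties to x and y.
  M : Formula L 4
  M = σ ⟪ var (# 2) ∷ var (# 3) ∷ var (# 0) ∷ [] ⟫ ∧ Proofᵀ ⟪ var (# 1) ∷ var (# 0) ∷ [] ⟫

  code : ℕ → ℕ → ℕ
  code n m = ⌜ φ ⟦ n ∷ m ∷ [] ⟧ ⌝

  derivation : ∀ n → T ⊢ φ ⟦ n ∷ f n ∷ [] ⟧
  derivation n = proj₁ (weak n (f n)) refl

  proof : ℕ → ℕ
  proof n = ⌜ derivation n ⌝ᵖ

  M≡ : ∀ n m c w → M ⟦ c ∷ w ∷ n ∷ m ∷ [] ⟧ ≡ σ ⟦ n ∷ m ∷ c ∷ [] ⟧ ∧ Proofᵀ ⟦ w ∷ c ∷ [] ⟧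
  M≡ n m c w = cong₂ _∧_
    (⟪⟫-⟦⟧ σ _ (c ∷ w ∷ n ∷ m ∷ []) (n ∷ m ∷ c ∷ []) refl)
    (⟪⟫-⟦⟧ Proofᵀ _ (c ∷ w ∷ n ∷ m ∷ []) (w ∷ c ∷ []) refl)

  witness : ∀ n → T ⊢ M ⟦ code n (f n) ∷ proof n ∷ n ∷ f n ∷ [] ⟧
  witness n = conv (sym (M≡ n (f n) (code n (f n)) (proof n)))
    (∧-intro (proj₁ (proj₂ (coding φ) n (f n) _) refl) (proves _ (derivation n)))

  -- If c is the code of φ(n,m), then (e) refutes every w, because weak representability excludes
  -- any proof of φ(n,m). Otherwise `σ` is refuted at c.
  rival : ∀ n m → f n ≢ m → ∀ c w → T ⊢ ~ (M ⟦ c ∷ w ∷ n ∷ m ∷ [] ⟧)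
  rival n m fn≢m c w = conv (cong ~_ (sym (M≡ n m c w))) (refute (code n m ≟ c))
    where
    refute : Dec (code n m ≡ c) → T ⊢ ~ (σ ⟦ n ∷ m ∷ c ∷ [] ⟧ ∧ Proofᵀ ⟦ w ∷ c ∷ [] ⟧)
    refute (yes refl) = cut (refutes _ w λ (d , _) → proj₂ (weak n m) fn≢m d)
      (⇒-intro (⇒-elim (hyp h₁) (∧-elim₂ (hyp h₀))))
    refute (no c≢)    = cut (proj₂ (proj₂ (coding φ) n m c) c≢)
      (⇒-intro (⇒-elim (hyp h₁) (∧-elim₁ (hyp h₀))))
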